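{- For every $n\ge 2$, the set of degrees of vertices of ${\rm OFG}(M_{2,n})$ (equivalently, the set of values of the number of flippable faces over all locally valid MV assignments of $M_{2,n}$) is exactly $\{2,3,4,\dots,2n-2,2n\}$.
   Context: The $2\times n$ Miura-ori $M_{2,n}$ ($n\ge1$) has faces $\alpha_{i,j}$ ($i\in\{1,2\}$, $j\in\{1,\dots,n\}$), interior vertices $x_1,\dots,x_{n-1}$, and creases $e_0$ and $e_{3k-1},e_{3k},e_{3k+1}$ ($k=1,\dots,n-1$). At $x_k$ the creases are left $e_{3k-3}$, top $e_{3k-1}$, right $e_{3k}$, bottom $e_{3k+1}$. Face $\alpha_{1,j}$ is bordered by those of $e_{3j-4}$ (iff $j\ge2$), $e_{3j-3}$, $e_{3j-1}$ (iff $j\le n-1$); $\alpha_{2,j}$ by those of $e_{3j-2}$ (iff $j\ge2$), $e_{3j-3}$, $e_{3j+1}$ (iff $j\le n-1$). An MV assignment $\mu$ maps creases to $\{1,-1\}$; it is locally valid if for each $k$ exactly one of $\mu(e_{3k-1}),\mu(e_{3k}),\mu(e_{3k+1})$ differs from $\mu(e_{3k-3})$. The face flip $\mu_\alpha$ negates $\mu$ on the creases bordering $\alpha$; $\alpha$ is flippable under $\mu$ if $\mu,\mu_\alpha$ are both locally valid. ${\rm OFG}(M_{2,n})$ has the locally valid assignments as vertices, with $\mu\sim\mu_\alpha$ for each flippable $\alpha$. -}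

module Defs where

open import Data.Bool.Base using (if_then_else_)
open import Data.Fin.Base using (Fin; zero; suc; toℕ; inject₁)
open import Data.Fin.Properties using (all?; toℕ-inject₁)
open import Data.List.Base using (List; length; filter; cartesianProduct; allFin)
open import Data.Nat.Base using (ℕ; zero; suc; _+_; _*_; _∸_; _≤_)
open import Data.Nat.Properties using (+-comm; *-suc) renaming (_≟_ to _≟ℕ_)
open import Data.Product.Base using (Σ; ∃; _×_; _,_)
open import Data.Sign.Base using (Sign; opposite)
open import Data.Sign.Properties using () renaming (_≟_ to _≟ˢ_)
open import Data.Sum.Base using (_⊎_)
open import Function.Bundles using (Inverse)
open import Level using (0ℓ)
open import Relation.Binary.Bundles using (Setoid)
open import Relation.Binary.PropositionalEquality using (_≡_; _≢_; _≗_; refl; sym; trans; setoid)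
open import Relation.Nullary using (¬_; Dec; does)
open import Relation.Nullary.Decidable using (_×-dec_; _⊎-dec_; ¬?)

-- `k : InteriorVertex n` is the vertex x_{toℕ k + 1}.
InteriorVertex : ℕ → Set
InteriorVertex n = Fin (n ∸ 1)

data Crease (n : ℕ) : Set where
  e₀               : Crease n
  top right bottom : InteriorVertex n → Crease n

-- The subscript in the numbering e_0, e_2, e_3, e_4, e_5, … (there is no e_1):
-- with k' = toℕ k + 1, these are 0, 3k'-1, 3k' and 3k'+1.
index : ∀ {n} → Crease n → ℕ
index e₀         = 0
index (top k)    = 3 * toℕ k + 2
index (right k)  = 3 * toℕ k + 3
index (bottom k) = 3 * toℕ k + 4

left : ∀ {n} → InteriorVertex n → Crease n
left {suc (suc n)} zero    = e₀
left {suc (suc n)} (suc k) = right (inject₁ k)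

-- The crease to the left of x_{k'} is e_{3k'-3}.
index-left : ∀ {n} (k : InteriorVertex n) → index (left {n} k) ≡ 3 * toℕ k
index-left {suc (suc n)} zero    = refl
index-left {suc (suc n)} (suc k) rewrite toℕ-inject₁ k =
  trans (+-comm (3 * toℕ k) 3) (sym (*-suc 3 (toℕ k)))

Face : ℕ → Set
Face n = Fin 2 × Fin n

-- The face (i , j) is α_{i',j'} with i' = toℕ i + 1 and j' = toℕ j + 1.
column : ∀ {n} → Fin n → ℕ
column j = suc (toℕ j)

-- Subtractions are moved across the equation, so nothing is truncated: e.g.
-- `index c + 4 ≡ 3 * j'` says c = e_{3j'-4}.  The side conditions j' ≥ 2 and
-- j' ≤ n-1 are automatic, as the subscripts they exclude (-1 and 1 for j' = 1;
-- 3n-1 and 3n+1 for j' = n) are not subscripts of creases.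
Borders : ∀ {n} → Face n → Crease n → Set
Borders (zero , j) c =
  index c + 4 ≡ 3 * column j ⊎ index c + 3 ≡ 3 * column j ⊎ index c + 1 ≡ 3 * column j
Borders (suc zero , j) c =
  index c + 2 ≡ 3 * column j ⊎ index c + 3 ≡ 3 * column j ⊎ index c ≡ 3 * column j + 1

borders? : ∀ {n} (α : Face n) (c : Crease n) → Dec (Borders α c)
borders? (zero , j) c =
  (index c + 4 ≟ℕ 3 * column j) ⊎-dec (index c + 3 ≟ℕ 3 * column j) ⊎-dec (index c + 1 ≟ℕ 3 * column j)
borders? (suc zero , j) c =
  (index c + 2 ≟ℕ 3 * column j) ⊎-dec (index c + 3 ≟ℕ 3 * column j) ⊎-dec (index c ≟ℕ 3 * column j + 1)

Assignment : ℕ → Set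
Assignment n = Crease n → Sign

ExactlyOne : Set → Set → Set → Set
ExactlyOne P Q R = (P × ¬ Q × ¬ R) ⊎ (¬ P × Q × ¬ R) ⊎ (¬ P × ¬ Q × R)

exactlyOne? : ∀ {P Q R} → Dec P → Dec Q → Dec R → Dec (ExactlyOne P Q R)
exactlyOne? p q r =
  (p ×-dec ¬? q ×-dec ¬? r) ⊎-dec (¬? p ×-dec q ×-dec ¬? r) ⊎-dec (¬? p ×-dec ¬? q ×-dec r)

LocallyValid : ∀ {n} → Assignment n → Set
LocallyValid {n} μ = (k : InteriorVertex n) →
  ExactlyOne (μ (top k) ≢ μ (left k)) (μ (right k) ≢ μ (left k)) (μ (bottom k) ≢ μ (left k))

locallyValid? : ∀ {n} (μ : Assignment n) → Dec (LocallyValid μ)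
locallyValid? μ = all? λ k →
  exactlyOne? (¬? (μ (top k) ≟ˢ μ (left k))) (¬? (μ (right k) ≟ˢ μ (left k))) (¬? (μ (bottom k) ≟ˢ μ (left k)))

faceFlip : ∀ {n} → Assignment n → Face n → Assignment n
faceFlip μ α c = if does (borders? α c) then opposite (μ c) else μ c

Flippable : ∀ {n} → Assignment n → Face n → Set
Flippable μ α = LocallyValid μ × LocallyValid (faceFlip μ α)

flippable? : ∀ {n} (μ : Assignment n) (α : Face n) → Dec (Flippable μ α)
flippable? μ α = locallyValid? μ ×-dec locallyValid? (faceFlip μ α)

allFaces : ∀ n → List (Face n)
allFaces n = cartesianProduct (allFin 2) (allFin n)

numFlippable : ∀ {n} → Assignment n → ℕ
numFlippable {n} μ = length (filter (flippable? μ) (allFaces n))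

-- The graph OFG(M_{2,n}).  Its vertices are assignments with a proof of local
-- validity; two are the same vertex when the assignments agree pointwise.
OFGVertex : ℕ → Set
OFGVertex n = Σ (Assignment n) LocallyValid

OFGAdjacent : ∀ {n} → OFGVertex n → OFGVertex n → Set
OFGAdjacent (μ , _) (ν , _) = ∃ λ α → Flippable μ α × ν ≗ faceFlip μ α

Neighbours : ∀ {n} → OFGVertex n → Setoid 0ℓ 0ℓ
Neighbours {n} v = record
  { Carrier       = Σ (OFGVertex n) (OFGAdjacent v)
  ; _≈_           = λ { ((μ , _) , _) ((ν , _) , _) → μ ≗ ν }
  ; isEquivalence = record
    { refl  = λ _ → refl
    ; sym   = λ p c → sym (p c)
    ; trans = λ p q c → trans (p c) (q c)
    }
  }

HasDegree : ∀ {n} → OFGVertex n → ℕ → Set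
HasDegree v d = Inverse (setoid (Fin d)) (Neighbours v)

-- d ∈ {2, 3, …, 2n-2} ∪ {2n}
InDegreeSet : ℕ → ℕ → Set
InDegreeSet n d = (2 ≤ d × d ≤ 2 * n ∸ 2) ⊎ d ≡ 2 * n

{-# OPTIONS --safe #-}

-- In a locally valid assignment, each interior vertex is determined by its left
-- crease and by which of the other three creases disagrees with it, so an
-- assignment amounts to the sign of e₀ and a word in {top, right, bottom}.
-- A flip of α_{1,j} only concerns the letters on either side of column j: it is
-- allowed unless the letter before is `bottom` or the letter after is `top`
-- (for α_{2,j}, exchange the roles of top and bottom).  If the word is padded by
-- `right` at both ends, a column between two `right`s has two flippable faces, a
-- column between equal letters other than `right` has none, and any other column
-- has one.  Hence the constant word `right` gives 2n; any other word loses at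
-- least one face on each side of a letter other than `right`, and keeps at least
-- one face before the first and after the last such letter.  Conversely
-- right^b top^a and right^b bottom top^a realise all even and odd values.
module Submission where

open import Algebra.Properties.CommutativeSemigroup using (interchange)
open import Data.Bool.Base using (Bool; true; false; _∧_; if_then_else_)
open import Data.Bool.Properties using (∧-conicalˡ; ∧-conicalʳ)
open import Data.Empty using (⊥)
open import Data.Fin.Base using (Fin; zero; suc; toℕ; inject₁)
open import Data.Fin.Permutation using (↔⇒≡)
open import Data.Fin.Properties using (toℕ-inject₁; toℕ-injective)
open import Data.List.Base using (List; _∷_; _++_; length; filter; tabulate; map; lookup; allFin)
open import Data.List.Membership.Propositional using (_∈_)
open import Data.List.Membership.Propositional.Properties using (∈-allFin; ∈-cartesianProduct⁺; ∈-filter⁺; ∈-filter⁻; ∈-lookup)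
open import Data.List.Properties using (length-++; filter-++; map-tabulate; ++-identityʳ)
open import Data.List.Relation.Unary.All as All using ()
open import Data.List.Relation.Unary.AllPairs using (_∷_)
open import Data.List.Relation.Unary.Any as Any using ()
open import Data.List.Relation.Unary.Any.Properties using (lookup-index)
open import Data.List.Relation.Unary.Unique.Propositional using (Unique)
open import Data.List.Relation.Unary.Unique.Propositional.Properties using (allFin⁺; cartesianProduct⁺; filter⁺)
open import Data.Nat.Base using (ℕ; zero; suc; _+_; _*_; _∸_; _≤_; z≤n; s≤s)
open import Data.Nat.DivMod using (_%_; [m+kn]%n≡m%n)
open import Data.Nat.Properties
open import Data.Product.Base using (∃; _×_; _,_; proj₁; proj₂)
open import Data.Sign.Base as Sign using (Sign; opposite)
open import Data.Sign.Properties using (s≢opposite[s]) renaming (_≟_ to _≟ˢ_)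
open import Data.Sum.Base using (_⊎_; inj₁; inj₂)
open import Data.Vec.Functional using () renaming (_∷_ to _◂_)
open import Function.Base using (_∘_; id)
open import Function.Bundles using (_⇔_; mk⇔; Equivalence)
import Function.Construct.Composition as Composition
import Function.Construct.Symmetry as Symmetry
open import Relation.Binary.Bundles using (Setoid)
open import Relation.Binary.PropositionalEquality using (_≡_; _≢_; _≗_; refl; sym; trans; cong; cong₂; subst; module ≡-Reasoning)
open import Relation.Nullary using (¬_; Dec; yes; no; does; contradiction)
open import Relation.Nullary.Decidable using (dec-true; dec-false; decidable-stable; ¬?)
open import Relation.Unary using (Decidable)
open import Defs

private
  variable
    m n : ℕ
    A : Set

-- Decisions as Booleans, and positions in duplicate-free lists.

does≡ : (a? : Dec A) (b : Bool) → (A → b ≡ true) → (b ≡ true → A) → does a? ≡ b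
does≡ (yes a) b     f g = sym (f a)
does≡ (no ¬a) false f g = refl
does≡ (no ¬a) true  f g = contradiction (g refl) ¬a

does⇒ : (a? : Dec A) → does a? ≡ true → A
does⇒ (yes a) _ = a

lookup-injective : {xs : List A} → Unique xs → ∀ i j → lookup xs i ≡ lookup xs j → i ≡ j
lookup-injective (_ ∷ _)  zero    zero    _  = refl
lookup-injective {xs = _ ∷ xs} (x∉ ∷ _) zero (suc j) eq = contradiction eq (All.lookup x∉ (∈-lookup {xs = xs} j))
lookup-injective {xs = _ ∷ xs} (x∉ ∷ _) (suc i) zero eq = contradiction (sym eq) (All.lookup x∉ (∈-lookup {xs = xs} i))
lookup-injective (_ ∷ u)  (suc i) (suc j) eq = cong suc (lookup-injective u i j eq)

-- Incidence of faces and creases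

private
  -- Rules out the pairs of crease type and border equation that clash modulo 3; for the compatible
  -- pairs, `quotient` then reads off the column.
  residue : ∀ a j r s → 3 * a + r ≡ 3 * j + s → r % 3 ≡ s % 3
  residue a j r s eq = trans (sym (reduce a r)) (trans (cong (_% 3) eq) (reduce j s))
    where
    reduce : ∀ b t → (3 * b + t) % 3 ≡ t % 3
    reduce b t = trans (cong (_% 3) (trans (+-comm (3 * b) t) (cong (t +_) (*-comm 3 b))))
                       ([m+kn]%n≡m%n t b 3)

  quotient : ∀ a j s → 3 * a + s ≡ 3 * j + s → a ≡ j
  quotient a j s eq = *-cancelˡ-≡ a j 3 (+-cancelʳ-≡ s (3 * a) (3 * j) eq)

  carry : ∀ a s → 3 * a + (3 + s) ≡ 3 * suc a + s
  carry a s = trans (sym (+-assoc (3 * a) 3 s))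
                    (cong (_+ s) (trans (+-comm (3 * a) 3) (sym (*-suc 3 a))))

  3*suc : ∀ j → 3 * suc j ≡ 3 * j + 3
  3*suc j = trans (*-suc 3 j) (+-comm 3 (3 * j))

-- The residue r is 0 for horizontal creases, 1 for bottom and 2 for top creases.
record Located (c : Crease n) (r : Fin 3) (a : ℕ) : Set where
  constructor located
  field index≡ : index c ≡ 3 * a + toℕ r

-- The arguments are the row i, the location (r , a) of a crease, and the column j.
Touches : Fin 2 → Fin 3 → ℕ → ℕ → Set
Touches _          zero             a j = a ≡ j
Touches zero       (suc zero)       a j = ⊥
Touches zero       (suc (suc zero)) a j = suc a ≡ j ⊎ a ≡ j
Touches (suc zero) (suc zero)       a j = a ≡ j ⊎ a ≡ suc j
Touches (suc zero) (suc (suc zero)) a j = ⊥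

module _ (μ : Assignment n) (α : Face n) (c : Crease n) where

  faceFlip-on : Borders α c → faceFlip μ α c ≡ opposite (μ c)
  faceFlip-on b = cong (λ f → if f then opposite (μ c) else μ c) (dec-true (borders? α c) b)

  faceFlip-off : ¬ Borders α c → faceFlip μ α c ≡ μ c
  faceFlip-off ¬b = cong (λ f → if f then opposite (μ c) else μ c) (dec-false (borders? α c) ¬b)

module _ {c : Crease n} {a : ℕ} where

  private
    toNormal : ∀ {r} s {j} → index c ≡ 3 * a + r → index c + s ≡ 3 * suc j → 3 * a + (r + s) ≡ 3 * j + 3
    toNormal {r} s {j} ic eq =
      trans (sym (trans (cong (_+ s) ic) (+-assoc (3 * a) r s))) (trans eq (3*suc j))

    -- Serves the one border equation whose offset stands on the right-hand side.
    toNormal₁ : ∀ {r j} → index c ≡ 3 * a + r → index c ≡ 3 * suc j + 1 → 3 * a + r ≡ 3 * j + 4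
    toNormal₁ {r} {j} ic eq = trans (sym ic) (trans eq (sym (carry j 1)))

    fromNormal : ∀ {r} s {j} → index c ≡ 3 * a + r → 3 * a + (r + s) ≡ 3 * j + 3 → index c + s ≡ 3 * suc j
    fromNormal {r} s {j} ic eq =
      trans (trans (cong (_+ s) ic) (+-assoc (3 * a) r s)) (trans eq (sym (3*suc j)))

  borders⇒touches : ∀ i {r} (j : Fin n) → Located c r a → Borders (i , j) c → Touches i r a (toℕ j)
  borders⇒touches zero {zero} j (located ic) (inj₁ p)        = contradiction (residue a (toℕ j) _ _ (toNormal 4 ic p)) λ ()
  borders⇒touches zero {zero} j (located ic) (inj₂ (inj₁ p)) = quotient a (toℕ j) 3 (toNormal 3 ic p)
  borders⇒touches zero {zero} j (located ic) (inj₂ (inj₂ p)) = contradiction (residue a (toℕ j) _ _ (toNormal 1 ic p)) λ ()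
  borders⇒touches zero {suc zero} j (located ic) (inj₁ p)        = contradiction (residue a (toℕ j) _ _ (toNormal 4 ic p)) λ ()
  borders⇒touches zero {suc zero} j (located ic) (inj₂ (inj₁ p)) = contradiction (residue a (toℕ j) _ _ (toNormal 3 ic p)) λ ()
  borders⇒touches zero {suc zero} j (located ic) (inj₂ (inj₂ p)) = contradiction (residue a (toℕ j) _ _ (toNormal 1 ic p)) λ ()
  -- Here residue 2 and shift 4 add up to 6 against 3 on the other side, so a unit is carried: the
  -- crease lies one column to the left of the face.
  borders⇒touches zero {suc (suc zero)} j (located ic) (inj₁ p)        = inj₁ (quotient (suc a) (toℕ j) 3 (trans (sym (carry a 3)) (toNormal 4 ic p)))
  borders⇒touches zero {suc (suc zero)} j (located ic) (inj₂ (inj₁ p)) = contradiction (residue a (toℕ j) _ _ (toNormal 3 ic p)) λ ()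
  borders⇒touches zero {suc (suc zero)} j (located ic) (inj₂ (inj₂ p)) = inj₂ (quotient a (toℕ j) 3 (toNormal 1 ic p))
  borders⇒touches (suc zero) {zero} j (located ic) (inj₁ p)        = contradiction (residue a (toℕ j) _ _ (toNormal 2 ic p)) λ ()
  borders⇒touches (suc zero) {zero} j (located ic) (inj₂ (inj₁ p)) = quotient a (toℕ j) 3 (toNormal 3 ic p)
  borders⇒touches (suc zero) {zero} j (located ic) (inj₂ (inj₂ p)) = contradiction (residue a (toℕ j) _ _ (toNormal₁ ic p)) λ ()
  borders⇒touches (suc zero) {suc zero} j (located ic) (inj₁ p)        = inj₁ (quotient a (toℕ j) 3 (toNormal 2 ic p))
  borders⇒touches (suc zero) {suc zero} j (located ic) (inj₂ (inj₁ p)) = contradiction (residue a (toℕ j) _ _ (toNormal 3 ic p)) λ ()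
  borders⇒touches (suc zero) {suc zero} j (located ic) (inj₂ (inj₂ p)) = inj₂ (quotient a (suc (toℕ j)) 1 (trans (sym ic) p))
  borders⇒touches (suc zero) {suc (suc zero)} j (located ic) (inj₁ p)        = contradiction (residue a (toℕ j) _ _ (toNormal 2 ic p)) λ ()
  borders⇒touches (suc zero) {suc (suc zero)} j (located ic) (inj₂ (inj₁ p)) = contradiction (residue a (toℕ j) _ _ (toNormal 3 ic p)) λ ()
  borders⇒touches (suc zero) {suc (suc zero)} j (located ic) (inj₂ (inj₂ p)) = contradiction (residue a (toℕ j) _ _ (toNormal₁ ic p)) λ ()

  touches⇒borders : ∀ i {r} (j : Fin n) → Located c r a → Touches i r a (toℕ j) → Borders (i , j) c
  touches⇒borders zero {zero} j (located ic) refl        = inj₂ (inj₁ (fromNormal 3 ic refl))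
  touches⇒borders (suc zero) {zero} j (located ic) refl        = inj₂ (inj₁ (fromNormal 3 ic refl))
  touches⇒borders zero {suc (suc zero)} j (located ic) (inj₁ p) =
    inj₁ (fromNormal 4 ic (trans (carry a 3) (cong (λ b → 3 * b + 3) p)))
  touches⇒borders zero {suc (suc zero)} j (located ic) (inj₂ refl) = inj₂ (inj₂ (fromNormal 1 ic refl))
  touches⇒borders (suc zero) {suc zero} j (located ic) (inj₁ refl) = inj₁ (fromNormal 2 ic refl)
  touches⇒borders (suc zero) {suc zero} j (located ic) (inj₂ refl) = inj₂ (inj₂ ic)
  touches⇒borders (suc zero) {suc (suc zero)} j (located ic) ()

  module _ (μ : Assignment n) where

    flip-touching : ∀ i {r} (j : Fin n) → Located c r a → Touches i r a (toℕ j) →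
                    faceFlip μ (i , j) c ≡ opposite (μ c)
    flip-touching i j at t = faceFlip-on μ (i , j) c (touches⇒borders i j at t)

    flip-apart : ∀ i {r} (j : Fin n) → Located c r a → ¬ Touches i r a (toℕ j) →
                 faceFlip μ (i , j) c ≡ μ c
    flip-apart i j at ¬t = faceFlip-off μ (i , j) c (¬t ∘ borders⇒touches i j at)

module _ (k : Fin m) where

  left-at : Located (left {suc m} k) zero (toℕ k)
  left-at = located (trans (index-left {suc m} k) (sym (+-identityʳ (3 * toℕ k))))

  top-at : Located {suc m} (top k) (suc (suc zero)) (toℕ k)
  top-at = located refl

  -- The offsets 3 and 4 of right and bottom creases carry a unit into the quotient, whereas the
  -- offset 2 of top creases does not.
  right-at : Located {suc m} (right k) zero (suc (toℕ k))
  right-at = located (carry (toℕ k) 0)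

  bottom-at : Located {suc m} (bottom k) (suc zero) (suc (toℕ k))
  bottom-at = located (carry (toℕ k) 1)

-- Words of a locally valid assignment

data Letter : Set where
  top right bottom : Letter

topSign rightSign bottomSign : Letter → Sign → Sign
topSign top = opposite
topSign _   = id
rightSign right = opposite
rightSign _     = id
bottomSign bottom = opposite
bottomSign _      = id

HasWord : Assignment (suc m) → (Fin m → Letter) → Set
HasWord μ w = ∀ k → μ (top k) ≡ topSign (w k) (μ (left k))
                  × μ (right k) ≡ rightSign (w k) (μ (left k))
                  × μ (bottom k) ≡ bottomSign (w k) (μ (left k))

Valid : Sign → Sign → Sign → Sign → Set
Valid l t r b = ExactlyOne (t ≢ l) (r ≢ l) (b ≢ l)

valid? : ∀ l t r b → Dec (Valid l t r b)
valid? l t r b = exactlyOne? (¬? (t ≟ˢ l)) (¬? (r ≟ˢ l)) (¬? (b ≟ˢ l))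

validAt? : (μ : Assignment n) (k : InteriorVertex n) →
           Dec (Valid (μ (left k)) (μ (top k)) (μ (right k)) (μ (bottom k)))
validAt? μ k = valid? (μ (left k)) (μ (top k)) (μ (right k)) (μ (bottom k))

valid?-cong : ∀ {l l′ t t′ r r′ b b′} → l ≡ l′ → t ≡ t′ → r ≡ r′ → b ≡ b′ →
              does (valid? l t r b) ≡ does (valid? l′ t′ r′ b′)
valid?-cong refl refl refl refl = refl

≢⇒≡opposite : ∀ s t → s ≢ t → s ≡ opposite t
≢⇒≡opposite Sign.+ Sign.+ s≢t = contradiction refl s≢t
≢⇒≡opposite Sign.+ Sign.- s≢t = refl
≢⇒≡opposite Sign.- Sign.+ s≢t = refl
≢⇒≡opposite Sign.- Sign.- s≢t = contradiction refl s≢t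

letterOf : ∀ l t r b → Valid l t r b →
           ∃ λ x → t ≡ topSign x l × r ≡ rightSign x l × b ≡ bottomSign x l
letterOf l t r b (inj₁ (t≢l , r≡l , b≡l)) =
  top , ≢⇒≡opposite t l t≢l , decidable-stable (r ≟ˢ l) r≡l , decidable-stable (b ≟ˢ l) b≡l
letterOf l t r b (inj₂ (inj₁ (t≡l , r≢l , b≡l))) =
  right , decidable-stable (t ≟ˢ l) t≡l , ≢⇒≡opposite r l r≢l , decidable-stable (b ≟ˢ l) b≡l
letterOf l t r b (inj₂ (inj₂ (t≡l , r≡l , b≢l))) =
  bottom , decidable-stable (t ≟ˢ l) t≡l , decidable-stable (r ≟ˢ l) r≡l , ≢⇒≡opposite b l b≢l

wordOf : (μ : Assignment (suc m)) → LocallyValid μ → ∃ (HasWord μ)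
wordOf μ v = proj₁ ∘ letters , proj₂ ∘ letters
  where letters = λ k → letterOf (μ (left k)) (μ (top k)) (μ (right k)) (μ (bottom k)) (v k)

-- `beforeOK i x`: a face of row i with the letter x at its right end may be
-- flipped as far as x is concerned; `afterOK i x`: same with x at its left end.
beforeOK afterOK : Fin 2 → Letter → Bool
beforeOK zero       top    = false
beforeOK (suc zero) bottom = false
beforeOK _          _      = true
afterOK zero       bottom = false
afterOK (suc zero) top    = false
afterOK _          _      = true

valid-word : ∀ x l → does (valid? l (topSign x l) (rightSign x l) (bottomSign x l)) ≡ true
valid-word top    Sign.+ = refl
valid-word top    Sign.- = refl
valid-word right  Sign.+ = refl
valid-word right  Sign.- = refl
valid-word bottom Sign.+ = refl
valid-word bottom Sign.- = refl

-- Negating the left and top creases keeps whether top agrees with left and toggles this for the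
-- other two. The letter `top` would make all three disagree; otherwise `right` and `bottom` are
-- exchanged. The bottom version is symmetric.
valid-flip-left-top : ∀ x l →
  does (valid? (opposite l) (opposite (topSign x l)) (rightSign x l) (bottomSign x l)) ≡ beforeOK zero x
valid-flip-left-top top    Sign.+ = refl
valid-flip-left-top top    Sign.- = refl
valid-flip-left-top right  Sign.+ = refl
valid-flip-left-top right  Sign.- = refl
valid-flip-left-top bottom Sign.+ = refl
valid-flip-left-top bottom Sign.- = refl

valid-flip-left-bottom : ∀ x l →
  does (valid? (opposite l) (topSign x l) (rightSign x l) (opposite (bottomSign x l))) ≡ beforeOK (suc zero) x
valid-flip-left-bottom top    Sign.+ = refl
valid-flip-left-bottom top    Sign.- = refl
valid-flip-left-bottom right  Sign.+ = refl
valid-flip-left-bottom right  Sign.- = refl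
valid-flip-left-bottom bottom Sign.+ = refl
valid-flip-left-bottom bottom Sign.- = refl

-- Only the agreements of top and right with left are toggled: the letter `bottom` would make all
-- three disagree, while `top` and `right` are exchanged. The bottom version is symmetric.
valid-flip-right-top : ∀ x l →
  does (valid? l (opposite (topSign x l)) (opposite (rightSign x l)) (bottomSign x l)) ≡ afterOK zero x
valid-flip-right-top top    Sign.+ = refl
valid-flip-right-top top    Sign.- = refl
valid-flip-right-top right  Sign.+ = refl
valid-flip-right-top right  Sign.- = refl
valid-flip-right-top bottom Sign.+ = refl
valid-flip-right-top bottom Sign.- = refl

valid-flip-right-bottom : ∀ x l →
  does (valid? l (topSign x l) (opposite (rightSign x l)) (opposite (bottomSign x l))) ≡ afterOK (suc zero) x
valid-flip-right-bottom top    Sign.+ = refl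
valid-flip-right-bottom top    Sign.- = refl
valid-flip-right-bottom right  Sign.+ = refl
valid-flip-right-bottom right  Sign.- = refl
valid-flip-right-bottom bottom Sign.+ = refl
valid-flip-right-bottom bottom Sign.- = refl

-- The letters on either side of a column, where p is the letter before the word.
before : Letter → (Fin m → Letter) → Fin (suc m) → Letter
before p w = p ◂ w

after : (Fin m → Letter) → Fin (suc m) → Letter
after {zero}  w _       = right
after {suc m} w zero    = w zero
after {suc m} w (suc j) = after (w ∘ suc) j

after-inject₁ : (w : Fin m → Letter) (k : Fin m) → after w (inject₁ k) ≡ w k
after-inject₁ w zero    = refl
after-inject₁ w (suc k) = after-inject₁ (w ∘ suc) k

-- Separates the last column, where the padding is read, from a column with an interior vertex at
-- its right end.
after-cases : (w : Fin m → Letter) (j : Fin (suc m)) →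
              after w j ≡ right ⊎ (∃ λ k → j ≡ inject₁ k × after w j ≡ w k)
after-cases {zero}  w j    = inj₁ refl
after-cases {suc m} w zero = inj₂ (zero , refl , refl)
after-cases {suc m} w (suc j) with after-cases (w ∘ suc) j
... | inj₁ eq            = inj₁ eq
... | inj₂ (k , jk , eq) = inj₂ (suc k , cong suc jk , eq)

flipOK : Fin 2 → Letter → Letter → Bool
flipOK i x y = afterOK i x ∧ beforeOK i y

module _ (μ : Assignment (suc m)) (w : Fin m → Letter) (hw : HasWord μ w) where

  private
    top≡    = λ k → proj₁ (hw k)
    right≡  = λ k → proj₁ (proj₂ (hw k))
    bottom≡ = λ k → proj₂ (proj₂ (hw k))

  hasWord⇒valid : LocallyValid μ
  hasWord⇒valid k = does⇒ (validAt? μ k)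
    (trans (valid?-cong refl (top≡ k) (right≡ k) (bottom≡ k)) (valid-word (w k) (μ (left k))))

  module _ (j : Fin (suc m)) (k : Fin m) where

    -- Vertex `k` separates the columns numbered `k` and `k + 1`, so here it is at the right end of
    -- column `j`. The face borders the left crease and one vertical crease of the vertex, but not
    -- its right crease.
    flip-before : ∀ i → toℕ j ≡ toℕ k → does (validAt? (faceFlip μ (i , j)) k) ≡ beforeOK i (w k)
    flip-before zero j≡k = trans
      (valid?-cong
        (flip-touching μ zero j (left-at k) (sym j≡k))
        (trans (flip-touching μ zero j (top-at k) (inj₂ (sym j≡k))) (cong opposite (top≡ k)))
        (trans (flip-apart μ zero j (right-at k) λ eq → 1+n≢n (trans eq j≡k)) (right≡ k))
        (trans (flip-apart μ zero j (bottom-at k) λ ()) (bottom≡ k)))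
      (valid-flip-left-top (w k) (μ (left k)))
    flip-before (suc zero) j≡k = trans
      (valid?-cong
        (flip-touching μ (suc zero) j (left-at k) (sym j≡k))
        (trans (flip-apart μ (suc zero) j (top-at k) λ ()) (top≡ k))
        (trans (flip-apart μ (suc zero) j (right-at k) λ eq → 1+n≢n (trans eq j≡k)) (right≡ k))
        (trans (flip-touching μ (suc zero) j (bottom-at k) (inj₂ (cong suc (sym j≡k)))) (cong opposite (bottom≡ k))))
      (valid-flip-left-bottom (w k) (μ (left k)))

    flip-after : ∀ i → toℕ j ≡ suc (toℕ k) → does (validAt? (faceFlip μ (i , j)) k) ≡ afterOK i (w k)
    flip-after zero j≡1+k = trans
      (valid?-cong
        (flip-apart μ zero j (left-at k) λ eq → 1+n≢n (sym (trans eq j≡1+k)))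
        (trans (flip-touching μ zero j (top-at k) (inj₁ (sym j≡1+k))) (cong opposite (top≡ k)))
        (trans (flip-touching μ zero j (right-at k) (sym j≡1+k)) (cong opposite (right≡ k)))
        (trans (flip-apart μ zero j (bottom-at k) λ ()) (bottom≡ k)))
      (valid-flip-right-top (w k) (μ (left k)))
    flip-after (suc zero) j≡1+k = trans
      (valid?-cong
        (flip-apart μ (suc zero) j (left-at k) λ eq → 1+n≢n (sym (trans eq j≡1+k)))
        (trans (flip-apart μ (suc zero) j (top-at k) λ ()) (top≡ k))
        (trans (flip-touching μ (suc zero) j (right-at k) (sym j≡1+k)) (cong opposite (right≡ k)))
        (trans (flip-touching μ (suc zero) j (bottom-at k) (inj₁ (sym j≡1+k))) (cong opposite (bottom≡ k))))
      (valid-flip-right-bottom (w k) (μ (left k)))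

    flip-away : ∀ i → toℕ j ≢ toℕ k → toℕ j ≢ suc (toℕ k) → does (validAt? (faceFlip μ (i , j)) k) ≡ true
    flip-away i j≢k j≢1+k = trans
      (valid?-cong
        (flip-apart μ i j (left-at k) (j≢k ∘ sym))
        (trans (flip-apart μ i j (top-at k) (untouched-top i)) (top≡ k))
        (trans (flip-apart μ i j (right-at k) (j≢1+k ∘ sym)) (right≡ k))
        (trans (flip-apart μ i j (bottom-at k) (untouched-bottom i)) (bottom≡ k)))
      (valid-word (w k) (μ (left k)))
      where
      untouched-top : ∀ i → ¬ Touches i (suc (suc zero)) (toℕ k) (toℕ j)
      untouched-top zero       (inj₁ eq) = j≢1+k (sym eq)
      untouched-top zero       (inj₂ eq) = j≢k (sym eq)
      untouched-top (suc zero) ()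
      untouched-bottom : ∀ i → ¬ Touches i (suc zero) (suc (toℕ k)) (toℕ j)
      untouched-bottom zero       ()
      untouched-bottom (suc zero) (inj₁ eq) = j≢1+k (sym eq)
      untouched-bottom (suc zero) (inj₂ eq) = j≢k (sym (suc-injective eq))

  -- A flip can spoil validity only at the two ends of its column; each end contributes one factor
  -- of the conjunction.
  flippable-word : ∀ i j → does (flippable? μ (i , j)) ≡ flipOK i (before right w j) (after w j)
  flippable-word i j = does≡ (flippable? μ (i , j)) _
    (λ (_ , v) → cong₂ _∧_ (afterOK-before j v) (beforeOK-after j v))
    (λ ok → hasWord⇒valid , flipped-valid ok)
    where
    -- The padding letter forbids no flip in either row, so a missing end vertex imposes no
    -- condition.
    right-afterOK : ∀ i → afterOK i right ≡ true
    right-afterOK zero       = refl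
    right-afterOK (suc zero) = refl

    right-beforeOK : ∀ i → beforeOK i right ≡ true
    right-beforeOK zero       = refl
    right-beforeOK (suc zero) = refl

    afterOK-before : ∀ j → LocallyValid (faceFlip μ (i , j)) → afterOK i (before right w j) ≡ true
    afterOK-before zero    v = right-afterOK i
    afterOK-before (suc k) v =
      trans (sym (flip-after (suc k) k i refl)) (dec-true (validAt? (faceFlip μ (i , suc k)) k) (v k))

    beforeOK-after : ∀ j → LocallyValid (faceFlip μ (i , j)) → beforeOK i (after w j) ≡ true
    beforeOK-after j v with after-cases w j
    ... | inj₁ eq = trans (cong (beforeOK i) eq) (right-beforeOK i)
    ... | inj₂ (k , refl , eq) = trans (cong (beforeOK i) eq)
      (trans (sym (flip-before j k i (toℕ-inject₁ k))) (dec-true (validAt? (faceFlip μ (i , j)) k) (v k)))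

    flipped-valid : flipOK i (before right w j) (after w j) ≡ true → LocallyValid (faceFlip μ (i , j))
    flipped-valid ok k with toℕ j ≟ toℕ k | toℕ j ≟ suc (toℕ k)
    ... | yes j≡k | _ = does⇒ (validAt? (faceFlip μ (i , j)) k) (trans (flip-before j k i j≡k)
      -- The equality of numbers gives `j ≡ inject₁ k`, so the letter after column `j` is `w k`.
      (trans (cong (beforeOK i) (sym (trans
        (cong (after w) (toℕ-injective (trans j≡k (sym (toℕ-inject₁ k))))) (after-inject₁ w k))))
        (∧-conicalʳ _ _ ok)))
    ... | no _ | yes j≡1+k = does⇒ (validAt? (faceFlip μ (i , j)) k) (trans (flip-after j k i j≡1+k)
      (trans (cong (afterOK i ∘ before right w) (sym (toℕ-injective {i = j} {j = suc k} j≡1+k)))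
        (∧-conicalˡ _ _ ok)))
    ... | no j≢k | no j≢1+k = does⇒ (validAt? (faceFlip μ (i , j)) k) (flip-away j k i j≢k j≢1+k)

-- Counting flippable faces along a word

bit : Bool → ℕ
bit b = if b then 1 else 0

rowCount : Fin 2 → Letter → (Fin m → Letter) → ℕ
rowCount {zero}  i p w = bit (flipOK i p right)
rowCount {suc m} i p w = bit (flipOK i p (w zero)) + rowCount i (w zero) (w ∘ suc)

columnCount : Letter → Letter → ℕ
columnCount x y = bit (flipOK zero x y) + bit (flipOK (suc zero) x y)

wordCount : Letter → (Fin m → Letter) → ℕ
wordCount {zero}  p w = columnCount p right
wordCount {suc m} p w = columnCount p (w zero) + wordCount (w zero) (w ∘ suc)

-- The list of faces runs along rows, while the bounds are proved column by column; this exchanges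
-- the order of summation.
rowCount-sum : ∀ p (w : Fin m → Letter) → rowCount zero p w + rowCount (suc zero) p w ≡ wordCount p w
rowCount-sum {zero}  p w = refl
rowCount-sum {suc m} p w = trans
  (interchange +-commutativeSemigroup (bit (flipOK zero p (w zero))) _ (bit (flipOK (suc zero) p (w zero))) _)
  (cong (columnCount p (w zero) +_) (rowCount-sum (w zero) (w ∘ suc)))

-- The preceding letter `p` is arbitrary because the induction passes to the columns after the
-- first, which `w zero` precedes.
length-filter-tabulate : {P : A → Set} (P? : Decidable P) (f : Fin (suc m) → A) → ∀ i p (w : Fin m → Letter) →
  (∀ j → does (P? (f j)) ≡ flipOK i (before p w j) (after w j)) →
  length (filter P? (tabulate f)) ≡ rowCount i p w
length-filter-tabulate {m = zero} P? f i p w eq rewrite sym (eq zero) with does (P? (f zero))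
... | true  = refl
... | false = refl
length-filter-tabulate {m = suc m} P? f i p w eq
  with does (P? (f zero)) | eq zero | length-filter-tabulate P? (f ∘ suc) i (w zero) (w ∘ suc)
         -- `before (w zero) (w ∘ suc)` reduces only on a constructor, hence the split.
         (λ { zero → eq (suc zero) ; (suc j) → eq (suc (suc j)) })
... | true  | e | rest rewrite sym e = cong suc rest
... | false | e | rest rewrite sym e = rest

numFlippable-word : (μ : Assignment (suc m)) (w : Fin m → Letter) → HasWord μ w →
                    numFlippable μ ≡ wordCount right w
numFlippable-word {m} μ w hw = begin
  length (filter (flippable? μ) (row zero ++ (row (suc zero) ++ _)))
    ≡⟨ cong (λ xs → length (filter (flippable? μ) (row zero ++ xs))) (++-identityʳ _) ⟩
  length (filter (flippable? μ) (row zero ++ row (suc zero)))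
    ≡⟨ cong length (filter-++ (flippable? μ) (row zero) _) ⟩
  length (filter (flippable? μ) (row zero) ++ filter (flippable? μ) (row (suc zero)))
    ≡⟨ length-++ (filter (flippable? μ) (row zero)) ⟩
  length (filter (flippable? μ) (row zero)) + length (filter (flippable? μ) (row (suc zero)))
    ≡⟨ cong₂ _+_ (length-row zero) (length-row (suc zero)) ⟩
  rowCount zero right w + rowCount (suc zero) right w
    ≡⟨ rowCount-sum right w ⟩
  wordCount right w ∎
  where
  open ≡-Reasoning
  row : Fin 2 → List (Face (suc m))
  row i = map (i ,_) (allFin (suc m))
  length-row : ∀ i → length (filter (flippable? μ) (row i)) ≡ rowCount i right w
  length-row i = trans (cong (length ∘ filter (flippable? μ)) (map-tabulate id (i ,_)))
    (length-filter-tabulate (flippable? μ) (i ,_) i right w (flippable-word μ w hw i))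

-- Bounds on the count.

mutual
  -- This is where the gap at one below the maximum arises: when a letter other than `right` first
  -- occurs, one face is lost in the column before it, and `wordCount-≢right` shows that at least
  -- one more is lost from there on.
  wordCount-right : (w : Fin m → Letter) →
    (2 ≤ wordCount right w × wordCount right w ≤ m * 2) ⊎ wordCount right w ≡ suc m * 2
  wordCount-right {zero} w = inj₂ refl
  wordCount-right {suc m} w with w zero
  ... | top    = let lo , hi = wordCount-≢right (w ∘ suc) top (λ ()) in inj₁ (s≤s lo , s≤s hi)
  ... | bottom = let lo , hi = wordCount-≢right (w ∘ suc) bottom (λ ()) in inj₁ (s≤s lo , s≤s hi)
  ... | right with wordCount-right (w ∘ suc)
  ...   | inj₁ (lo , hi) = inj₁ (m≤m+n 2 _ , +-monoʳ-≤ 2 hi)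
  ...   | inj₂ eq        = inj₂ (cong (2 +_) eq)

  wordCount-right-≤ : (w : Fin m → Letter) → wordCount right w ≤ suc m * 2
  wordCount-right-≤ w with wordCount-right w
  ... | inj₁ (_ , hi) = m≤n⇒m≤o+n 2 hi
  ... | inj₂ eq       = ≤-reflexive eq

  -- The run of letters equal to `p` ends, at the latest at the padding. The column where it ends
  -- has exactly one flippable face, which yields the lower bound and also the loss of one in the
  -- upper bound.
  wordCount-≢right : (w : Fin m → Letter) → ∀ p → p ≢ right →
    1 ≤ wordCount p w × wordCount p w ≤ suc (m * 2)
  wordCount-≢right w right p≢ = contradiction refl p≢
  wordCount-≢right {zero} w top    _ = ≤-refl , ≤-refl
  wordCount-≢right {zero} w bottom _ = ≤-refl , ≤-refl
  wordCount-≢right {suc m} w top p≢ with w zero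
  ... | top    = let lo , hi = wordCount-≢right (w ∘ suc) top p≢ in lo , m≤n⇒m≤o+n 2 hi
  ... | right  = s≤s z≤n , s≤s (wordCount-right-≤ (w ∘ suc))
  ... | bottom = let _ , hi = wordCount-≢right (w ∘ suc) bottom (λ ()) in s≤s z≤n , m≤n⇒m≤1+n (s≤s hi)
  wordCount-≢right {suc m} w bottom p≢ with w zero
  ... | top    = let _ , hi = wordCount-≢right (w ∘ suc) top (λ ()) in s≤s z≤n , m≤n⇒m≤1+n (s≤s hi)
  ... | right  = s≤s z≤n , s≤s (wordCount-right-≤ (w ∘ suc))
  ... | bottom = let lo , hi = wordCount-≢right (w ∘ suc) bottom p≢ in lo , m≤n⇒m≤o+n 2 hi

-- Words attaining the counts.

wordCount-all-top : ∀ m → wordCount {m} top (λ _ → top) ≡ 1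
wordCount-all-top zero    = refl
wordCount-all-top (suc m) = wordCount-all-top m

wordCount-all-right : ∀ m → wordCount {m} right (λ _ → right) ≡ suc m * 2
wordCount-all-right zero    = refl
wordCount-all-right (suc m) = cong (2 +_) (wordCount-all-right m)

wordCount-surjective : ∀ m d → 2 ≤ d → d ≤ m * 2 → ∃ λ (w : Fin m → Letter) → wordCount right w ≡ d
wordCount-surjective zero (suc _) _ ()
wordCount-surjective (suc m) 1 (s≤s ()) _
-- Only the two outer columns, between `top` and the padding, have a flippable face.
wordCount-surjective (suc m) 2 _ _ = (λ _ → top) , cong suc (wordCount-all-top m)
wordCount-surjective (suc zero) 3 _ (s≤s (s≤s ()))
-- The column between `bottom` and `top` supplies the third face.
wordCount-surjective (suc (suc m)) 3 _ _ = bottom ◂ (λ _ → top) , cong (2 +_) (wordCount-all-top m)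
-- A leading `right` adds a column with two flippable faces, so the length drops by one and the
-- target by two.
wordCount-surjective (suc m) (suc (suc (suc (suc d)))) _ (s≤s (s≤s d≤))
  with w , eq ← wordCount-surjective m (suc (suc d)) (s≤s (s≤s z≤n)) d≤
  = right ◂ w , cong (2 +_) eq

-- The assignment with a given word.

spineSign : Sign → (Fin m → Letter) → Fin (suc m) → Sign
spineSign s w zero = s
spineSign {suc m} s w (suc k) = spineSign (rightSign (w zero) s) (w ∘ suc) k

spineSign-suc : ∀ s (w : Fin m → Letter) k → spineSign s w (suc k) ≡ rightSign (w k) (spineSign s w (inject₁ k))
spineSign-suc s w zero    = refl
spineSign-suc s w (suc k) = spineSign-suc (rightSign (w zero) s) (w ∘ suc) k

fromWord : (Fin m → Letter) → Assignment (suc m)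
fromWord w e₀         = Sign.+
fromWord w (top k)    = topSign (w k) (spineSign Sign.+ w (inject₁ k))
fromWord w (right k)  = spineSign Sign.+ w (suc k)
fromWord w (bottom k) = bottomSign (w k) (spineSign Sign.+ w (inject₁ k))

fromWord-left : (w : Fin m → Letter) (k : Fin m) → fromWord w (left k) ≡ spineSign Sign.+ w (inject₁ k)
fromWord-left {suc m} w zero    = refl
fromWord-left {suc m} w (suc k) = refl

fromWord-hasWord : (w : Fin m → Letter) → HasWord (fromWord w) w
fromWord-hasWord w k
  = cong (topSign (w k)) (sym (fromWord-left w k))
  , trans (spineSign-suc Sign.+ w k) (cong (rightSign (w k)) (sym (fromWord-left w k)))
  , cong (bottomSign (w k)) (sym (fromWord-left w k))

numFlippable-set : ∀ m d →
  (∃ λ (v : OFGVertex (suc m)) → numFlippable (proj₁ v) ≡ d) ⇔ InDegreeSet (suc m) d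
numFlippable-set m d = mk⇔ bounded attained
  where
  full : suc m * 2 ≡ 2 * suc m
  full = *-comm (suc m) 2

  partial : m * 2 ≡ 2 * suc m ∸ 2
  partial = cong (_∸ 2) full

  wordCount-bounded : (w : Fin m → Letter) → InDegreeSet (suc m) (wordCount right w)
  wordCount-bounded w with wordCount-right w
  ... | inj₁ (lo , hi) = inj₁ (lo , ≤-trans hi (≤-reflexive partial))
  ... | inj₂ eq        = inj₂ (trans eq full)

  bounded : (∃ λ (v : OFGVertex (suc m)) → numFlippable (proj₁ v) ≡ d) → InDegreeSet (suc m) d
  bounded ((μ , v) , eq) = let w , hw = wordOf μ v in
    subst (InDegreeSet (suc m)) (trans (sym (numFlippable-word μ w hw)) eq) (wordCount-bounded w)

  attain : (w : Fin m → Letter) → wordCount right w ≡ d → ∃ λ (v : OFGVertex (suc m)) → numFlippable (proj₁ v) ≡ d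
  attain w eq = (fromWord w , hasWord⇒valid (fromWord w) w (fromWord-hasWord w))
              , trans (numFlippable-word (fromWord w) w (fromWord-hasWord w)) eq

  attained : InDegreeSet (suc m) d → ∃ λ (v : OFGVertex (suc m)) → numFlippable (proj₁ v) ≡ d
  attained (inj₁ (lo , hi)) with w , eq ← wordCount-surjective m d lo (≤-trans hi (≤-reflexive (sym partial)))
    = attain w eq
  attained (inj₂ d≡2n) = attain (λ _ → right) (trans (wordCount-all-right m) (trans full (sym d≡2n)))

-- Flippable faces correspond to neighbours

-- The horizontal crease of a column borders both faces of that column and no others, so it detects
-- the column of a flip.
spine : Fin (suc m) → Crease (suc m)
spine zero    = e₀
spine (suc k) = right k

spine-at : (j : Fin (suc m)) → Located (spine j) zero (toℕ j)
spine-at zero    = located refl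
spine-at (suc k) = right-at k

-- A sign differs from its opposite, so the flipped assignment reveals which creases border the
-- face.
borders-resp-flip : (μ : Assignment n) (α β : Face n) (c : Crease n) →
                    faceFlip μ α c ≡ faceFlip μ β c → Borders α c → Borders β c
borders-resp-flip μ α β c eq b = decidable-stable (borders? β c) λ ¬b →
  s≢opposite[s] (μ c) (trans (sym (faceFlip-off μ β c ¬b)) (trans (sym eq) (faceFlip-on μ α c b)))

-- Needs an interior vertex: on a single column both faces border only `e₀`, and their flips
-- coincide. The first column uses the top crease at its right end, the others the one at their left
-- end.
top-separates-rows : (j : Fin (suc (suc m))) →
  ∃ λ (c : Crease (suc (suc m))) → Borders (zero , j) c × (∀ j′ → ¬ Borders (suc zero , j′) c)
top-separates-rows {m} zero =
  top zero , touches⇒borders zero zero (top-at {suc m} zero) (inj₂ refl)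
           , λ j′ → borders⇒touches (suc zero) j′ (top-at {suc m} zero)
top-separates-rows (suc k) =
  top k , touches⇒borders zero (suc k) (top-at k) (inj₁ refl)
        , λ j′ → borders⇒touches (suc zero) j′ (top-at k)

faceFlip-injective : (μ : Assignment (suc (suc m))) (α β : Face (suc (suc m))) →
                     faceFlip μ α ≗ faceFlip μ β → α ≡ β
faceFlip-injective μ (i , j) (i′ , j′) eq = cong₂ _,_ (sameRow i i′ eq) sameColumn
  where
  sameColumn : j ≡ j′
  sameColumn = toℕ-injective (borders⇒touches i′ j′ (spine-at j)
    (borders-resp-flip μ (i , j) (i′ , j′) (spine j) (eq (spine j))
      (touches⇒borders i j (spine-at j) refl)))

  sameRow : ∀ i i′ → faceFlip μ (i , j) ≗ faceFlip μ (i′ , j′) → i ≡ i′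
  sameRow zero       zero       eq = refl
  sameRow (suc zero) (suc zero) eq = refl
  sameRow zero       (suc zero) eq with c , b , ¬b ← top-separates-rows j =
    contradiction (borders-resp-flip μ (zero , j) (suc zero , j′) c (eq c) b) (¬b j′)
  sameRow (suc zero) zero       eq with c , b , ¬b ← top-separates-rows j′ =
    contradiction (borders-resp-flip μ (zero , j′) (suc zero , j) c (sym (eq c)) b) (¬b j)

-- Neighbours are compared as assignments, ignoring the face that witnesses adjacency. As distinct
-- faces have distinct flips, the duplicate-free list of flippable faces enumerates them exactly
-- once.
hasDegree-numFlippable : (v : OFGVertex (suc (suc m))) → HasDegree v (numFlippable (proj₁ v))
hasDegree-numFlippable {m} v@(μ , _) = record
  { to        = to
  ; from      = from
  ; to-cong   = λ { refl _ → refl }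
  -- Congruence and the second inverse law both reduce to `from-unique`: the resulting assignment
  -- fixes the position in the list.
  ; from-cong = λ {x} {y} x≈y → from-unique x (from y) λ c →
                  trans (x≈y c) (trans (flips y c) (cong (λ α → faceFlip μ α c) (sym (lookup-from y))))
  ; inverse   = (λ { {x} refl c → trans (cong (λ α → faceFlip μ α c) (lookup-from x)) (sym (flips x c)) })
              , (λ {x} {y} y≈x → from-unique y x y≈x)
  }
  where
  open Setoid (Neighbours v) using () renaming (Carrier to Neighbour)

  faces : List (Face (suc (suc m)))
  faces = filter (flippable? μ) (allFaces (suc (suc m)))

  faces-unique : Unique faces
  faces-unique = filter⁺ (flippable? μ) (cartesianProduct⁺ (allFin⁺ 2) (allFin⁺ (suc (suc m))))

  face∈faces : ∀ {α} → Flippable μ α → α ∈ faces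
  face∈faces {i , j} = ∈-filter⁺ (flippable? μ) (∈-cartesianProduct⁺ (∈-allFin i) (∈-allFin j))

  to : Fin (length faces) → Neighbour
  to x = (faceFlip μ (lookup faces x) , proj₂ flippable) , lookup faces x , flippable , λ _ → refl
    where
    flippable : Flippable μ (lookup faces x)
    flippable = proj₂ (∈-filter⁻ (flippable? μ) {xs = allFaces (suc (suc m))} (∈-lookup {xs = faces} x))

  from : Neighbour → Fin (length faces)
  from (_ , _ , flippable , _) = Any.index (face∈faces flippable)

  faceOf : Neighbour → Face (suc (suc m))
  faceOf (_ , α , _) = α

  assignment : Neighbour → Assignment (suc (suc m))
  assignment ((ν , _) , _) = ν

  flips : ∀ y → assignment y ≗ faceFlip μ (faceOf y)
  flips (_ , _ , _ , eq) = eq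

  lookup-from : ∀ y → lookup faces (from y) ≡ faceOf y
  lookup-from (_ , _ , flippable , _) = sym (lookup-index (face∈faces flippable))

  from-unique : ∀ y x → assignment y ≗ faceFlip μ (lookup faces x) → from y ≡ x
  from-unique y x eq = lookup-injective faces-unique (from y) x
    (trans (lookup-from y) (faceFlip-injective μ (faceOf y) (lookup faces x) λ c → trans (sym (flips y c)) (eq c)))

-- From numbers of flippable faces to degrees.

hasDegree-unique : (v : OFGVertex n) → ∀ {d e} → HasDegree v d → HasDegree v e → d ≡ e
hasDegree-unique v p q = ↔⇒≡ (Composition.inverse p (Symmetry.inverse q))

theorem4p9 : (n : ℕ) → 2 ≤ n →
    ((d : ℕ) → (∃ λ (v : OFGVertex n) → HasDegree v d) ⇔ InDegreeSet n d)
    × ((d : ℕ) → (∃ λ (v : OFGVertex n) → numFlippable (proj₁ v) ≡ d) ⇔ InDegreeSet n d)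
    × ((v : OFGVertex n) → HasDegree v (numFlippable (proj₁ v)))
theorem4p9 (suc (suc m)) (s≤s (s≤s _)) = degrees , numFlippable-set (suc m) , hasDegree-numFlippable
  where
  degrees : ∀ d → (∃ λ (v : OFGVertex (suc (suc m))) → HasDegree v d) ⇔ InDegreeSet (suc (suc m)) d
  degrees d = mk⇔
    (λ (v , p) → Equivalence.to (numFlippable-set (suc m) d)
                   (v , hasDegree-unique v (hasDegree-numFlippable v) p))
    (λ d∈ → let v , eq = Equivalence.from (numFlippable-set (suc m) d) d∈ in
            v , subst (HasDegree v) eq (hasDegree-numFlippable v))
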